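{- $\mathfrak{icp}(\mathsf{meager}\setminus\{\emptyset\},\subseteq)=\operatorname{add}(\mathsf{meager})$.
   Context: $\mathsf{meager}$ is the ideal of meager subsets of $2^\omega$, ordered by inclusion. For a poset $(P,\le)$, $F\subseteq P$ is an incomparable family if for every $p\in P$ there is $q\in F$ with $p\not\le q$ and $q\not\le p$; $\mathfrak{icp}(P)$ is the minimal size of an incomparable family. $\operatorname{add}(\mathsf{meager})$ is the minimal size of a family of meager sets whose union is not meager. -}

module Defs where

open import Level using (Level; 0ℓ; suc; _⊔_)
open import Data.Bool using (Bool)
open import Data.Nat using (ℕ; _<_)
open import Data.Product using (Σ; ∃; _×_; proj₁)
open import Function.Bundles using (_↣_)
open import Function.Definitions using (Injective)
open import Relation.Binary.Bundles using (Poset)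
import Relation.Binary.Construct.On as On
open import Relation.Binary.PropositionalEquality using (_≡_)
open import Relation.Nullary using (¬_)
open import Relation.Unary using (Pred; _⊆_; _≐_; _≬_; ∅; Empty; ⋃)
open import Relation.Unary.Relation.Binary.Subset using (⊆-poset)

-- The space 2^ω.
Cantor : Set
Cantor = ℕ → Bool

-- The cylinders at x form a neighbourhood base at x in the product topology.
Cylinder : Cantor → ℕ → Pred Cantor 0ℓ
Cylinder x n y = ∀ i → i < n → y i ≡ x i

Interior : ∀ {ℓ} → Pred Cantor ℓ → Pred Cantor ℓ
Interior A x = ∃ λ n → Cylinder x n ⊆ A

Closure : ∀ {ℓ} → Pred Cantor ℓ → Pred Cantor ℓ
Closure A x = ∀ n → Cylinder x n ≬ A

NowhereDense : ∀ {ℓ} → Pred Cantor ℓ → Set ℓ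
NowhereDense A = Empty (Interior (Closure A))

Meager : ∀ {ℓ} → Pred Cantor ℓ → Set (suc ℓ)
Meager {ℓ} A = Σ (ℕ → Pred Cantor ℓ) λ N →
  (∀ n → NowhereDense (N n)) × A ≐ ⋃ ℕ N

-- Two elements are identified when they have the same points, irrespective of
-- the meagerness and nonemptiness proofs they carry.
Meager∖∅ : Poset (suc 0ℓ) 0ℓ 0ℓ
Meager∖∅ = On.poset (⊆-poset Cantor 0ℓ)
  (proj₁ {B = λ A → Meager A × ¬ (A ≐ ∅)})

-- Cardinals are represented by types, compared by injections: κ is the least
-- cardinality for which Φ holds.
IsLeastCardinal : ∀ {k ℓ} → (Set k → Set ℓ) → Set k → Set (suc k ⊔ ℓ)
IsLeastCardinal {k} Φ κ = Φ κ × ((μ : Set k) → Φ μ → κ ↣ μ)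

module _ {c ℓ₁ ℓ₂} (P : Poset c ℓ₁ ℓ₂) where
  open Poset P

  IsIncomparableFamily : {κ : Set c} → (κ → Carrier) → Set (c ⊔ ℓ₂)
  IsIncomparableFamily F = ∀ p → ∃ λ i → ¬ (p ≤ F i) × ¬ (F i ≤ p)

  -- A subset of P of size κ is the range of an injection from κ.  Since κ
  -- ranges over the universe of the carrier, every subset arises this way
  -- (classically).
  HasIncomparableFamily : Set c → Set (c ⊔ ℓ₁ ⊔ ℓ₂)
  HasIncomparableFamily κ = Σ (κ → Carrier) λ F →
    Injective _≡_ _≈_ F × IsIncomparableFamily F

  -- κ = 𝔦𝔠𝔭(P)
  IsIcp : Set c → Set (suc c ⊔ ℓ₁ ⊔ ℓ₂)
  IsIcp = IsLeastCardinal HasIncomparableFamily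

HasNonmeagerUnion : Set₁ → Set₂
HasNonmeagerUnion κ = Σ (κ → Pred Cantor 0ℓ) λ F →
  Injective _≡_ _≐_ F × (∀ i → Meager (F i)) × ¬ Meager (⋃ κ F)

-- κ = add(meager)
IsAddMeager : Set₁ → Set₂
IsAddMeager = IsLeastCardinal HasNonmeagerUnion

{-# OPTIONS --safe #-}

-- The union of an incomparable family is not meager, as it would otherwise be a
-- meager set above every member.  Conversely, let G be a family of meager sets
-- with nonmeager union.  Move it by x ↦ 0⌢x into the half {y | y 0 = 0}, and
-- replace one member (the empty one, if present) by a singleton D in the other
-- half; dropping one meager set leaves the union nonmeager.  A nonempty meager
-- p fails to contain some moved member q; if p ⊆ q, then p lies in the first
-- half and is incomparable to D.  So the two invariants minimise over the same
-- cardinals.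
--
-- The minimum exists because any family of types Xᵢ has a least one under
-- injections: a maximal set of tuples in Π Xᵢ with injective coordinates must
-- exhaust some Xᵢ.  The choice used here comes from excluded middle, which
-- decides arbitrary types and not only propositions.
module Submission where

open import Defs
open import Level using (Level; 0ℓ; Lift; lift; lower; _⊔_) renaming (suc to lsuc)
open import Data.Bool using (Bool; true; false; not; T)
open import Data.Bool.Properties using (not-¬)
open import Data.Empty using (⊥-elim)
open import Data.Nat using (ℕ; zero; suc; _≤_; _<_; s≤s; z≤n; _<?_)
import Data.Nat as ℕ
import Data.Nat.Properties as ℕ
open import Data.Product using (Σ; ∃; _×_; _,_; proj₁; proj₂)
open import Data.Sum using (_⊎_; inj₁; inj₂; [_,_]′)
open import Data.Unit using (tt)
open import Axiom.ExcludedMiddle using (ExcludedMiddle)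
open import Axiom.Extensionality.Propositional using (Extensionality)
open import Function using (_∘_)
open import Function.Bundles using (_↣_; mk↣)
open import Function.Definitions using (Injective)
open import Relation.Binary.Bundles using (Poset)
open import Relation.Binary.PropositionalEquality
  using (_≡_; _≢_; refl; sym; trans; cong; cong-app; subst)
open import Relation.Nullary using (¬_; Dec; yes; no; contradiction)
open import Relation.Nullary.Decidable
  using (⌊_⌋; True; toWitness; fromWitness; decidable-stable)
open import Relation.Unary using (Pred; _⊆_; _≐_; _∪_; Empty; ⋃; ∅)

private variable
  a b ℓ ℓ′ : Level

module Classical
  (em : ∀ ℓ → ExcludedMiddle ℓ)
  (ext : ∀ a b → Extensionality a b)
  where

  -- Consequences of excluded middle.

  ¬∀⇒∃¬ : {A : Set a} {P : A → Set b} → ¬ (∀ x → P x) → ∃ λ x → ¬ P x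
  ¬∀⇒∃¬ ¬∀ = decidable-stable (em _) λ ¬∃ →
    ¬∀ λ x → decidable-stable (em _) λ ¬Px → ¬∃ (x , ¬Px)

  -- Deciding `P` leaves only a Boolean, which fits into any universe.
  Resize : ∀ ℓ′ → Set ℓ → Set ℓ′
  Resize ℓ′ P = Lift ℓ′ (True (em _ {P}))

  resize : {P : Set ℓ} → P → Resize ℓ′ P
  resize p = lift (fromWitness p)

  unresize : {P : Set ℓ} → Resize ℓ′ P → P
  unresize (lift p) = toWitness p

  -- The least type of a family

  module LeastType {I : Set a} (X : I → Set b) (i₀ : I) where

    Tuple : Set (a ⊔ b)
    Tuple = ∀ i → X i

    -- Boolean-valued subsets are extensional and do not raise the universe
    -- level, so that towers can contain unions over all towers.
    Subset : Set (a ⊔ b)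
    Subset = Tuple → Bool

    infix 4 _≼_ _∈_
    _∈_ : Tuple → Subset → Set
    t ∈ C = T (C t)

    _≼_ : Subset → Subset → Set (a ⊔ b)
    C ≼ D = ∀ {t} → t ∈ C → t ∈ D

    ≼-antisym : ∀ {C D} → C ≼ D → D ≼ C → C ≡ D
    ≼-antisym {C} {D} C≼D D≼C = ext _ _ λ t → T-injective (C t) (D t) C≼D D≼C
      where
      T-injective : ∀ x y → (T x → T y) → (T y → T x) → x ≡ y
      T-injective true  true  _ _ = refl
      T-injective true  false f _ = ⊥-elim (f tt)
      T-injective false true  _ g = ⊥-elim (g tt)
      T-injective false false _ _ = refl

    ⟦_⟧ : Pred Tuple ℓ → Subset
    ⟦ P ⟧ t = ⌊ em _ {P t} ⌋

    ⟦⟧⁺ : {P : Pred Tuple ℓ} {t : Tuple} → P t → t ∈ ⟦ P ⟧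
    ⟦⟧⁺ = fromWitness

    ⟦⟧⁻ : {P : Pred Tuple ℓ} {t : Tuple} → t ∈ ⟦ P ⟧ → P t
    ⟦⟧⁻ {P = P} {t} = toWitness {a? = em _ {P t}}

    Fresh : Subset → Tuple → Set (a ⊔ b)
    Fresh C t = ∀ i {s} → s ∈ C → s i ≢ t i

    -- The decision is an argument so that proofs can match on it where `em _` would not reduce.
    extend : (C : Subset) → Dec (∃ (Fresh C)) → Subset
    extend C (yes (t , _)) = ⟦ (λ s → s ∈ C ⊎ s ≡ t) ⟧
    extend C (no _)        = C

    infix 8 _⁺
    _⁺ : Subset → Subset
    C ⁺ = extend C (em _)

    ≼⁺ : ∀ C → C ≼ C ⁺
    ≼⁺ C = ≼extend (em _)
      where
      ≼extend : ∀ d → C ≼ extend C d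
      ≼extend (yes (t , _)) s∈C = ⟦⟧⁺ {P = λ s → s ∈ C ⊎ s ≡ t} (inj₁ s∈C)
      ≼extend (no _)        s∈C = s∈C

    ⋁ : (Subset → Bool) → Subset
    ⋁ S = ⟦ (λ t → ∃ λ C → T (S C) × t ∈ C) ⟧

    ⋁-upper : ∀ {S C} → T (S C) → C ≼ ⋁ S
    ⋁-upper {S} {C} C∈S t∈C =
      ⟦⟧⁺ {P = λ t → ∃ λ C → T (S C) × t ∈ C} (C , C∈S , t∈C)

    ⋁-least : ∀ {S D} → (∀ {C} → T (S C) → C ≼ D) → ⋁ S ≼ D
    ⋁-least {S} upper t∈⋁ =
      let C , C∈S , t∈C = ⟦⟧⁻ {P = λ t → ∃ λ C → T (S C) × t ∈ C} t∈⋁ in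
      upper C∈S t∈C

    -- Zermelo's towers replace transfinite recursion. The empty set is the union of no towers.
    data Tower : Subset → Set (a ⊔ b) where
      grow  : ∀ {C} → Tower C → Tower (C ⁺)
      union : ∀ {S} → (∀ {C} → T (S C) → Tower C) → Tower (⋁ S)

    ⋁-split : ∀ S {D} {Q : Subset → Set ℓ} →
      (∀ {C} → T (S C) → C ≼ D ⊎ Q C) → ⋁ S ≼ D ⊎ ∃ λ C → T (S C) × Q C
    ⋁-split S {Q = Q} split with em _ {∃ λ C → T (S C) × Q C}
    ... | yes q = inj₂ q
    ... | no ¬q = inj₁ (⋁-least λ {C} C∈S →
      [ (λ C≼D → C≼D) , (λ q → ⊥-elim (¬q (C , C∈S , q))) ]′ (split C∈S))

    -- No tower lies strictly between `C` and `C ⁺` once `C` is comparable with all towers.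
    -- Induction on `D`.
    grow-gap : ∀ {C D} → (∀ {E} → Tower E → C ≼ E ⊎ E ⁺ ≼ C) →
      Tower D → C ≼ D → C ⁺ ≼ D ⊎ D ≼ C
    grow-gap {C} cmp (grow {D} D-tower) C≼D⁺ with cmp D-tower
    ... | inj₂ D⁺≼C = inj₂ D⁺≼C
    ... | inj₁ C≼D with grow-gap cmp D-tower C≼D
    ...   | inj₁ C⁺≼D = inj₁ λ t∈C⁺ → ≼⁺ D (C⁺≼D t∈C⁺)
    -- `_⁺` depends on a choice and need not be monotone, so `C` and `D` must first be made equal.
    ...   | inj₂ D≼C  = inj₁ λ {t} → subst (λ E → t ∈ E ⁺) (≼-antisym {C} {D} C≼D D≼C)
    grow-gap {C} cmp (union {S} S-tower) _ with ⋁-split S below-or-above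
      where
      below-or-above : ∀ {D} → T (S D) → D ≼ C ⊎ C ⁺ ≼ D
      below-or-above {D} D∈S with cmp (S-tower D∈S)
      ... | inj₂ D⁺≼C = inj₁ λ t∈D → D⁺≼C (≼⁺ D t∈D)
      ... | inj₁ C≼D with grow-gap cmp (S-tower D∈S) C≼D
      ...   | inj₁ C⁺≼D = inj₂ C⁺≼D
      ...   | inj₂ D≼C  = inj₁ D≼C
    ... | inj₁ ⋁≼C = inj₂ ⋁≼C
    ... | inj₂ (D , D∈S , C⁺≼D) = inj₁ λ t∈C⁺ → ⋁-upper {S} D∈S (C⁺≼D t∈C⁺)

    -- Induction on `C`: the induction hypothesis is the comparability that `grow-gap` asks for.
    tower-linear : ∀ {C D} → Tower C → Tower D → C ≼ D ⊎ D ⁺ ≼ C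
    tower-linear {D = D} (grow {C} C-tower) D-tower with tower-linear C-tower D-tower
    ... | inj₂ D⁺≼C = inj₂ λ t∈D⁺ → ≼⁺ C (D⁺≼C t∈D⁺)
    ... | inj₁ C≼D with grow-gap (tower-linear C-tower) D-tower C≼D
    ...   | inj₁ C⁺≼D = inj₁ C⁺≼D
    ...   | inj₂ D≼C  = inj₂ λ {t} → subst (λ E → t ∈ E ⁺) (≼-antisym {D} {C} D≼C C≼D)
    tower-linear (union {S} S-tower) D-tower
      with ⋁-split S (λ C∈S → tower-linear (S-tower C∈S) D-tower)
    ... | inj₁ ⋁≼D = inj₁ ⋁≼D
    ... | inj₂ (C , C∈S , D⁺≼C) = inj₂ λ t∈D⁺ → ⋁-upper {S} C∈S (D⁺≼C t∈D⁺)

    -- Sets of tuples with injective coordinates.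

    Matching : Subset → Set (a ⊔ b)
    Matching C = ∀ i {s t} → s ∈ C → t ∈ C → s i ≡ t i → s ≡ t

    extend-matching : ∀ {C} d → Matching C → Matching (extend C d)
    extend-matching (no _) m = m
    extend-matching {C} (yes (u , fresh)) m i s∈ t∈ eq
      with ⟦⟧⁻ {P = λ s → s ∈ C ⊎ s ≡ u} s∈ | ⟦⟧⁻ {P = λ s → s ∈ C ⊎ s ≡ u} t∈
    ... | inj₁ s∈C  | inj₁ t∈C  = m i s∈C t∈C eq
    ... | inj₁ s∈C  | inj₂ refl = contradiction eq (fresh i s∈C)
    ... | inj₂ refl | inj₁ t∈C  = contradiction (sym eq) (fresh i t∈C)
    ... | inj₂ refl | inj₂ refl = refl

    tower-matching : ∀ {C} → Tower C → Matching C
    tower-matching (grow C-tower) = extend-matching (em _) (tower-matching C-tower)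
    tower-matching (union {S} S-tower) i s∈ t∈ eq
      with ⟦⟧⁻ {P = λ t → ∃ λ C → T (S C) × t ∈ C} s∈
         | ⟦⟧⁻ {P = λ t → ∃ λ C → T (S C) × t ∈ C} t∈
    ... | C , C∈S , s∈C | D , D∈S , t∈D
      -- By linearity both tuples lie in the larger of the two towers.
      with tower-linear (S-tower C∈S) (S-tower D∈S)
    ...   | inj₁ C≼D  = tower-matching (S-tower D∈S) i (C≼D s∈C) t∈D eq
    ...   | inj₂ D⁺≼C = tower-matching (S-tower C∈S) i s∈C (D⁺≼C (≼⁺ D t∈D)) eq

    isTower : Subset → Bool
    isTower C = ⌊ em _ {Tower C} ⌋

    top : Subset
    top = ⋁ isTower

    top-tower : Tower top
    top-tower = union λ {C} → toWitness {a? = em _ {Tower C}}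

    -- `top ⁺` is again a tower, hence below `top`. An added tuple would already be in `top` and
    -- differ from itself at `i₀`.
    top-maximal : ¬ ∃ (Fresh top)
    top-maximal e = absurd (em _) (⋁-upper {isTower} (fromWitness (grow top-tower)))
      where
      absurd : ∀ d → ¬ (extend top d ≼ top)
      absurd (no ¬e) _ = ¬e e
      absurd (yes (t , fresh)) extend≼top =
        fresh i₀ (extend≼top (⟦⟧⁺ {P = λ s → s ∈ top ⊎ s ≡ t} (inj₂ refl))) refl

    -- If every coordinate missed a value, the missed values would form a fresh tuple.
    exhausted : ∃ λ i → ∀ x → ∃ λ t → t ∈ top × t i ≡ x
    exhausted = decidable-stable (em _) λ ¬exhausted →
      let unused i = ¬∀⇒∃¬ (λ all → ¬exhausted (i , all)) in
      top-maximal ((λ i → proj₁ (unused i)) ,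
                   λ i {s} s∈top eq → proj₂ (unused i) (s , s∈top , eq))

    -- Send `x` to the `j`-th entry of a tuple in `top` whose `i`-th entry is `x`. Equal `j`-th
    -- entries force equal tuples, hence equal `i`-th entries.
    least-type : ∃ λ i → ∀ j → X i ↣ X j
    least-type =
      let i , hit = exhausted in
      i , λ j → mk↣ {to = λ x → proj₁ (hit x) j} λ {x} {y} eq →
        let s , s∈top , si≡x = hit x
            t , t∈top , ti≡y = hit y
            s≡t = tower-matching top-tower j s∈top t∈top eq
        in trans (sym si≡x) (trans (cong-app s≡t i) ti≡y)

  -- The meager ideal

  -- The pieces are cut down to `B` because `Meager` asks for equality with their union. Resizing
  -- lets `A` and `B` have different levels.
  meager-⊆ : {A : Pred Cantor ℓ} {B : Pred Cantor ℓ′} → B ⊆ A → Meager A → Meager B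
  meager-⊆ {ℓ′ = ℓ′} {B = B} B⊆A (N , nwd , A⊆⋃N , _) =
    (λ n x → Resize ℓ′ (N n x) × B x) ,
    (λ n x (k , cyl⊆) → nwd n x (k , λ y∈cyl m →
      let z , z∈cyl , z∈N , _ = cyl⊆ y∈cyl m in z , z∈cyl , unresize z∈N)) ,
    (λ x∈B → let n , x∈N = A⊆⋃N (B⊆A x∈B) in n , resize x∈N , x∈B) ,
    λ (_ , _ , x∈B) → x∈B

  module _ {A : Set a} where

    interleave : (f g : ℕ → A) → ℕ → A
    interleave f g zero    = f zero
    interleave f g (suc n) = interleave g (f ∘ suc) n

    interleave-all : {P : A → Set ℓ} → ∀ {f g} → (∀ n → P (f n)) → (∀ n → P (g n)) →
      ∀ n → P (interleave f g n)
    interleave-all pf pg zero = pf zero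
    interleave-all {P = P} pf pg (suc n) = interleave-all {P = P} pg (pf ∘ suc) n

    interleaveˡ : ∀ f g n → ∃ λ m → interleave f g m ≡ f n
    interleaveʳ : ∀ f g n → ∃ λ m → interleave f g m ≡ g n
    interleaveˡ f g zero    = zero , refl
    interleaveˡ f g (suc n) = let m , eq = interleaveʳ g (f ∘ suc) n in suc m , eq
    interleaveʳ f g n       = let m , eq = interleaveˡ g (f ∘ suc) n in suc m , eq

  meager-∪ : {A B : Pred Cantor ℓ} → Meager A → Meager B → Meager (A ∪ B)
  meager-∪ {A = A} {B} (M , M-nwd , A⊆ , ⊆A) (N , N-nwd , B⊆ , ⊆B) =
    interleave M N , interleave-all {P = NowhereDense} M-nwd N-nwd ,
    (λ { {x} (inj₁ x∈A) → let n , x∈M = A⊆ x∈A ; m , eq = interleaveˡ M N n in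
                          m , subst (λ Q → Q x) (sym eq) x∈M
       ; {x} (inj₂ x∈B) → let n , x∈N = B⊆ x∈B ; m , eq = interleaveʳ M N n in
                          m , subst (λ Q → Q x) (sym eq) x∈N }) ,
    λ (n , x∈) → interleave-all {P = _⊆ A ∪ B}
      (λ n x∈M → inj₁ (⊆A (n , x∈M))) (λ n x∈N → inj₂ (⊆B (n , x∈N))) n x∈

  ｛_｝ : Cantor → Pred Cantor 0ℓ
  ｛ x ｝ y = y ≡ x

  -- Following `z` below `n` and flipping `x` from there on gives a point of the cylinder that
  -- already differs from `x` at `n`.
  singleton-meager : ∀ x → Meager ｛ x ｝
  singleton-meager x =
    (λ _ → ｛ x ｝) , (λ _ z (n , cyl⊆) → dense-in-cylinder z n cyl⊆) ,
    (λ eq → 0 , eq) , proj₂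
    where
    avoid : Cantor → ∀ n i → Dec (i < n) → Bool
    avoid z n i (yes _) = z i
    avoid z n i (no _)  = not (x i)

    avoid-below : ∀ z n i d → i < n → avoid z n i d ≡ z i
    avoid-below z n i (yes _)  _   = refl
    avoid-below z n i (no i≮n) i<n = contradiction i<n i≮n

    avoid-above : ∀ z n d → x n ≢ avoid z n n d
    avoid-above z n (yes n<n) = contradiction n<n (ℕ.<-irrefl refl)
    avoid-above z n (no _)    = not-¬ refl

    dense-in-cylinder : ∀ z n → ¬ (Cylinder z n ⊆ Closure ｛ x ｝)
    dense-in-cylinder z n cyl⊆
      with cyl⊆ {λ i → avoid z n i (i <? n)} (λ i → avoid-below z n i (i <? n)) (suc n)
    ... | _ , x∈cyl , refl = avoid-above z n (n <? n) (x∈cyl n (ℕ.n<1+n n))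

  -- The Baire category theorem for 2^ω

  -- Otherwise every point of the cylinder would lie in the closure of `N`.
  nowhereDense-escape : {N : Pred Cantor ℓ} → NowhereDense N → ∀ x n →
    ∃ λ y → Cylinder x n y × ∃ λ m → n < m × ∀ {z} → Cylinder y m z → ¬ N z
  nowhereDense-escape {N = N} nwd x n = decidable-stable (em _) λ stuck →
    nwd x (n , λ {y} y∈cyl m → decidable-stable (em _) λ disjoint →
      -- The maximum with `suc n` makes the radii increase strictly.
      stuck (y , y∈cyl , m ℕ.⊔ suc n , ℕ.m≤n⊔m m (suc n) , λ {z} z∈cyl z∈N →
        disjoint (z , (λ i i<m → z∈cyl i (ℕ.<-≤-trans i<m (ℕ.m≤m⊔n m (suc n)))) , z∈N)))

  nowhereDense-cover : (N : ℕ → Pred Cantor ℓ) → (∀ n → NowhereDense (N n)) →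
    ¬ (∀ x → ⋃ ℕ N x)
  nowhereDense-cover N nwd cover =
    let k , z∈N = cover limit in
    proj₂ (proj₂ (proj₂ (proj₂ (escape k)))) (limit-in-cylinder (suc k)) z∈N
    where
    centre : ℕ → Cantor
    radius : ℕ → ℕ
    escape : ∀ k → ∃ λ y → Cylinder (centre k) (radius k) y ×
      ∃ λ m → radius k < m × ∀ {z} → Cylinder y m z → ¬ N k z
    centre zero    = λ _ → false
    centre (suc k) = proj₁ (escape k)
    radius zero    = 0
    radius (suc k) = proj₁ (proj₂ (proj₂ (escape k)))
    escape k = nowhereDense-escape (nwd k) (centre k) (radius k)

    radius-< : ∀ k → radius k < radius (suc k)
    radius-< k = proj₁ (proj₂ (proj₂ (proj₂ (escape k))))

    k≤radius : ∀ k → k ≤ radius k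
    k≤radius zero    = z≤n
    k≤radius (suc k) = ℕ.≤-trans (s≤s (k≤radius k)) (radius-< k)

    nested : ∀ {k l} → k ℕ.≤′ l → ∀ {i} → i < radius k →
      i < radius l × centre l i ≡ centre k i
    nested ℕ.≤′-refl i<r = i<r , refl
    nested (ℕ.≤′-step {l} k≤l) i<r =
      let i<rₗ , eq = nested k≤l i<r in
      ℕ.<-trans i<rₗ (radius-< l) , trans (proj₁ (proj₂ (escape l)) _ i<rₗ) eq

    limit : Cantor
    -- Coordinate `i` is frozen from stage `suc i` on, as that radius exceeds `i`.
    limit i = centre (suc i) i

    limit-in-cylinder : ∀ k → Cylinder (centre k) (radius k) limit
    limit-in-cylinder k i i<r with ℕ.≤-total k (suc i)
    ... | inj₁ k≤1+i = proj₂ (nested (ℕ.≤⇒≤′ k≤1+i) i<r)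
    ... | inj₂ 1+i≤k = sym (proj₂ (nested (ℕ.≤⇒≤′ 1+i≤k) (k≤radius (suc i))))

  -- Supplies the nonempty index type that `least-type` needs.
  singletons-nonmeager : HasNonmeagerUnion (Lift (lsuc 0ℓ) Cantor)
  singletons-nonmeager =
    (λ x → ｛ lower x ｝) , (λ eq → cong lift (proj₁ eq refl)) ,
    (λ x → singleton-meager (lower x)) ,
    λ (N , nwd , ⊆N , _) → nowhereDense-cover N nwd λ x → ⊆N (lift x , refl)

  -- The embedding x ↦ 0⌢x

  infixr 5 _⌢_
  _⌢_ : Bool → Cantor → Cantor
  (b ⌢ x) zero    = b
  (b ⌢ x) (suc n) = x n

  tail : Cantor → Cantor
  tail x n = x (suc n)

  image : Pred Cantor ℓ → Pred Cantor ℓ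
  image A y = y 0 ≡ false × A (tail y)

  preimage : Pred Cantor ℓ → Pred Cantor ℓ
  preimage A x = A (false ⌢ x)

  image-meager : {A : Pred Cantor ℓ} → Meager A → Meager (image A)
  image-meager (N , nwd , A⊆ , ⊆A) =
    (λ n → image (N n)) , (λ n → image-nowhereDense (nwd n)) ,
    (λ (y0 , y∈A) → let n , y∈N = A⊆ y∈A in n , y0 , y∈N) ,
    λ (n , y0 , y∈N) → y0 , ⊆A (n , y∈N)
    where
    image-nowhereDense : {N : Pred Cantor ℓ} → NowhereDense N → NowhereDense (image N)
    image-nowhereDense {N = N} nwd x (n , cyl⊆) = nwd (tail x) (n , λ {w} w∈cyl m →
      -- Removing the first bit costs one coordinate of agreement, hence `suc m`.
      let z , z∈cyl , _ , z∈N = cyl⊆ {false ⌢ w} (in-cylinder w∈cyl) (suc m) in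
      tail z , (λ i i<m → z∈cyl (suc i) (s≤s i<m)) , z∈N)
      where
      x0 : x 0 ≡ false
      x0 = let z , z∈cyl , z0 , _ = cyl⊆ {x} (λ _ _ → refl) 1 in
           trans (sym (z∈cyl 0 (s≤s z≤n))) z0

      in-cylinder : ∀ {w} → Cylinder (tail x) n w → Cylinder x n (false ⌢ w)
      in-cylinder w∈cyl zero    _   = sym x0
      in-cylinder w∈cyl (suc i) i<n = w∈cyl i (ℕ.<-trans (ℕ.n<1+n i) i<n)

  preimage-meager : {A : Pred Cantor ℓ} → Meager A → Meager (preimage A)
  preimage-meager (N , nwd , A⊆ , ⊆A) =
    (λ n → preimage (N n)) , (λ n → preimage-nowhereDense (nwd n)) , A⊆ , ⊆A
    where
    preimage-nowhereDense : {N : Pred Cantor ℓ} →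
      NowhereDense N → NowhereDense (preimage N)
    preimage-nowhereDense {N = N} nwd x (n , cyl⊆) =
      -- Radius `suc n` fixes the first bit of `y` to `false` even when `n` is 0.
      nwd (false ⌢ x) (suc n , λ {y} y∈cyl m →
        let z , z∈cyl , z∈N =
              cyl⊆ {tail y} (λ i i<n → y∈cyl (suc i) (s≤s i<n)) m
        in false ⌢ z , in-cylinder y z (y∈cyl 0 (s≤s z≤n)) z∈cyl , z∈N)
      where
      in-cylinder : ∀ y z {m} → y 0 ≡ false → Cylinder (tail y) m z →
        Cylinder y m (false ⌢ z)
      in-cylinder y z y0 z∈cyl zero    _   = sym y0
      in-cylinder y z y0 z∈cyl (suc i) i<m = z∈cyl i (ℕ.<-trans (ℕ.n<1+n i) i<m)

  -- Incomparable families and families with nonmeager union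

  open Poset Meager∖∅ using (Carrier)

  singleton : Cantor → Carrier
  singleton x = ｛ x ｝ , singleton-meager x , λ (⊆∅ , _) → ⊆∅ refl

  incomparable⇒nonmeager : ∀ {κ} → HasIncomparableFamily Meager∖∅ κ → HasNonmeagerUnion κ
  incomparable⇒nonmeager {κ} (F , F-inj , incomparable) =
    (λ i → proj₁ (F i)) , F-inj , (λ i → proj₁ (proj₂ (F i))) ,
    λ union-meager →
      let bound : Carrier
          bound = U , meager-⊆ unresize union-meager , U-nonempty
          i , _ , F⊈bound = incomparable bound
      in F⊈bound (F⊆U i)
    where
    -- As `κ` is in `Set₁`, the plain union sits one level too high for `Carrier`.
    U : Pred Cantor 0ℓ
    U x = Resize 0ℓ (⋃ κ (λ i → proj₁ (F i)) x)

    F⊆U : ∀ i → proj₁ (F i) ⊆ U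
    F⊆U i x∈F = resize (i , x∈F)

    U-nonempty : ¬ (U ≐ ∅)
    U-nonempty (U⊆∅ , _) =
      -- Any element would do here: only an index is wanted.
      let i , _ = incomparable (singleton (λ _ → false)) in
      proj₂ (proj₂ (F i)) ((λ x∈F → U⊆∅ (F⊆U i x∈F)) , λ ())

  module _ {κ : Set₁} (G : κ → Pred Cantor 0ℓ) (G-inj : Injective _≡_ _≐_ G)
    (G-meager : ∀ i → Meager (G i)) (⋃G-nonmeager : ¬ Meager (⋃ κ G)) where

    -- Injectivity allows at most one empty member. If there is none, any index serves, and one
    -- exists since an empty union is meager.
    only-empty-index : ∃ λ i₀ → ∀ {i} → Empty (G i) → i ≡ i₀
    only-empty-index with em _ {∃ λ i → Empty (G i)}
    ... | yes (i₀ , ∅₀) = i₀ , λ ∅ᵢ →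
      G-inj ((λ {x} x∈G → ⊥-elim (∅ᵢ x x∈G)) , λ {x} x∈G → ⊥-elim (∅₀ x x∈G))
    ... | no all-nonempty with em _ {κ}
    ...   | yes i₀ = i₀ , λ {i} ∅ᵢ → ⊥-elim (all-nonempty (i , ∅ᵢ))
    ...   | no ¬κ  = contradiction
      (meager-⊆ (λ (i , _) → ⊥-elim (¬κ i)) (singleton-meager (λ _ → false))) ⋃G-nonmeager

    i₀ : κ
    i₀ = proj₁ only-empty-index

    D : Carrier
    D = singleton (λ _ → true)

    member : ∀ i → Dec (i ≡ i₀) → Carrier
    member i (yes _) = D
    member i (no i≢i₀) = image (G i) , image-meager (G-meager i) ,
      λ (⊆∅ , _) → i≢i₀ (proj₂ only-empty-index λ x x∈G → ⊆∅ {false ⌢ x} (refl , x∈G))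

    D⊈image : ∀ {i} → ¬ (proj₁ D ⊆ image (G i))
    D⊈image D⊆ with D⊆ refl
    ... | () , _

    member-injective : ∀ {i j} (d : Dec (i ≡ i₀)) (e : Dec (j ≡ i₀)) →
      proj₁ (member i d) ≐ proj₁ (member j e) → i ≡ j
    member-injective (yes refl) (yes refl) _ = refl
    member-injective {j = j} (yes _) (no _) (D⊆ , _) = ⊥-elim (D⊈image {j} D⊆)
    member-injective {i = i} (no _) (yes _) (_ , D⊆) = ⊥-elim (D⊈image {i} D⊆)
    member-injective (no _) (no _) (sub , sup) =
      G-inj ((λ {x} x∈G → proj₂ (sub {false ⌢ x} (refl , x∈G))) ,
             λ {x} x∈G → proj₂ (sup {false ⌢ x} (refl , x∈G)))

    Incomparable : Carrier → Carrier → Set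
    Incomparable (p , _) (q , _) = ¬ (p ⊆ q) × ¬ (q ⊆ p)

    -- Otherwise the preimage of `p` and the dropped `G i₀`, both meager, would cover the union.
    not-all-below : (p : Carrier) → ∃ λ i → i ≢ i₀ × ¬ (image (G i) ⊆ proj₁ p)
    not-all-below (p , p-meager , _) = decidable-stable (em _) λ all-below →
      ⋃G-nonmeager (meager-⊆
        (λ {x} (i , x∈G) → covered all-below i x∈G (em _))
        (meager-∪ (preimage-meager p-meager) (G-meager i₀)))
      where
      covered : ¬ (∃ λ i → i ≢ i₀ × ¬ (image (G i) ⊆ p)) →
        ∀ i {x} → G i x → Dec (i ≡ i₀) → (preimage p ∪ G i₀) x
      covered _ i x∈G (yes refl) = inj₂ x∈G
      covered all-below i {x} x∈G (no i≢i₀) = inj₁ (decidable-stable (em _) λ x∉p →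
        all-below (i , i≢i₀ , λ ⊆p → x∉p (⊆p {false ⌢ x} (refl , x∈G))))

    D-incomparable : ∀ {i} (p : Carrier) → proj₁ p ⊆ image (G i) → Incomparable p D
    D-incomparable {i} (p , _ , p-nonempty) p⊆ =
      (λ p⊆D → p-nonempty ((λ x∈p → absurd (p⊆D x∈p) (p⊆ x∈p)) , λ ())) ,
      λ D⊆p → D⊈image {i} λ x∈D → p⊆ (D⊆p x∈D)
      where
      absurd : ∀ {x} → x ≡ (λ _ → true) → image (G i) x → ∅ x
      absurd refl (() , _)

    member-incomparable : (p : Carrier) → ∃ λ i → Incomparable p (member i (em _))
    member-incomparable p with not-all-below p
    ... | i , i≢i₀ , image⊈p with em _ {proj₁ p ⊆ image (G i)}
    ...   | yes p⊆image = i₀ , at-i₀ (em _)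
      where
      at-i₀ : ∀ d → Incomparable p (member i₀ d)
      at-i₀ (yes _)    = D-incomparable {i} p p⊆image
      at-i₀ (no i₀≢i₀) = contradiction refl i₀≢i₀
    ...   | no p⊈image = i , at-i (em _)
      where
      at-i : ∀ d → Incomparable p (member i d)
      at-i (yes i≡i₀) = contradiction i≡i₀ i≢i₀
      at-i (no _)     = p⊈image , image⊈p

  nonmeager⇒incomparable : ∀ {κ} → HasNonmeagerUnion κ → HasIncomparableFamily Meager∖∅ κ
  nonmeager⇒incomparable (G , inj , meager , nonmeager) =
    (λ i → member G inj meager nonmeager i (em _)) ,
    (λ eq → member-injective G inj meager nonmeager (em _) (em _) eq) ,
    member-incomparable G inj meager nonmeager

  -- Both implications keep the index type, so a type least for nonmeager unions is also least for
  -- incomparable families.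
  icp≡add : ∃ λ (κ : Set₁) → IsIcp Meager∖∅ κ × IsAddMeager κ
  icp≡add =
    let (κ , nonmeager) , least = LeastType.least-type
          {I = Σ Set₁ HasNonmeagerUnion} proj₁ (_ , singletons-nonmeager)
    in κ ,
       (nonmeager⇒incomparable nonmeager ,
        λ μ incomparable → least (μ , incomparable⇒nonmeager incomparable)) ,
       (nonmeager , λ μ nonmeager′ → least (μ , nonmeager′))

mainTheorem15 : (∀ ℓ → ExcludedMiddle ℓ) →
    (∀ a b → Extensionality a b) →
    ∃ λ (κ : Set₁) → IsIcp Meager∖∅ κ × IsAddMeager κ
mainTheorem15 em ext = Classical.icp≡add em ext
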